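{- On the set of the $512$ mesh patterns $(21,R)$, $R\subseteq\{0,1,2\}\times\{0,1,2\}$, the equivalence relation of coincidence under $321$ (that is, $p_1\sim p_2$ if and only if $\mathrm{Av}(\{321,p_1\})=\mathrm{Av}(\{321,p_2\})$) has exactly $29$ equivalence classes.
   Context: Write $[n]=\{1,\dots,n\}$. A permutation of length $n$ is a bijection of $[n]$, written in one-line notation; $G(\pi)=\{(i,\pi(i)) : i\in[n]\}$ is its plot. A mesh pattern of length $k$ is a pair $p=(\tau,R)$ with $\tau$ a permutation of length $k$ and $R\subseteq\{0,\dots,k\}^2$. An occurrence of $p$ in a permutation $\pi$ of length $n$ is a subset $\omega\subseteq G(\pi)$ for which there are order-preserving injections $\alpha,\beta:[k]\to[n]$ such that (i) $\omega=\{(\alpha(i),\beta(j)):(i,j)\in G(\tau)\}$, and (ii) with $\alpha(0)=\beta(0)=0$, $\alpha(k+1)=\beta(k+1)=n+1$ and $R_{ij}=[\alpha(i)+1,\alpha(i+1)-1]\times[\beta(j)+1,\beta(j+1)-1]$, one has $R_{ij}\cap G(\pi)=\emptyset$ for every $(i,j)\in R$. A permutation avoids $p$ if it has no occurrence of $p$. A classical pattern $\pi$ is identified with the mesh pattern $(\pi,\emptyset)$. $\mathrm{Av}(S)$ is the set of all permutations (of all lengths, including the empty one) avoiding every pattern in $S$. -}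

module Defs where

open import Data.Fin.Base using (Fin; toℕ; fromℕ; inject₁) renaming (suc to fsuc; _≤_ to _≤ᶠ_)
open import Data.Fin.Permutation using (Permutation′; _⟨$⟩ʳ_; reverse)
open import Data.Fin.Subset using (Subset; ⊥; _∈_)
open import Data.Nat.Base using (ℕ; suc; _<_)
open import Data.Product.Base using (Σ; ∃; ∃-syntax; _×_; _,_)
open import Data.Vec.Base using (Vec; lookup; replicate)
open import Data.Vec.Functional using (Vector; insertAt; _∷_)
open import Function.Bundles using (Bijection)
open import Function.Definitions using (Injective)
open import Level using (Level; 0ℓ; _⊔_) renaming (suc to lsuc)
open import Relation.Binary.Bundles using (Setoid)
open import Relation.Binary.Core using (_Preserves_⟶_)
import Relation.Binary.Construct.On as On
open import Relation.Binary.PropositionalEquality.Core using (_≡_)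
open import Relation.Binary.PropositionalEquality.Properties using (setoid)
open import Relation.Nullary.Negation.Core using (¬_)
open import Relation.Unary using (Pred; Empty; _⊆_; _≐_; _∩_; _∪_; ｛_｝)
open import Relation.Unary.Relation.Binary.Equality using (≐-setoid)

private
  variable
    k n : ℕ
    a ℓ : Level

-- The element i of [n] is represented by the i' : Fin n with suc (toℕ i') ≡ i.

Perm : Set
Perm = Σ ℕ Permutation′

Plot : Permutation′ n → Pred (Fin n × Fin n) 0ℓ
Plot π (x , y) = π ⟨$⟩ʳ x ≡ y

-- A subset R of {0,…,k}², stored by its columns:
-- (i , j) belongs to R when j belongs to the i-th entry.
-- In particular Shading k has exactly 2 ^ ((k + 1) ²) elements.
Shading : ℕ → Set
Shading k = Vec (Subset (suc k)) (suc k)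

Shaded : Shading k → Pred (Fin (suc k) × Fin (suc k)) 0ℓ
Shaded R (i , j) = j ∈ lookup R i

record MeshPattern : Set where
  constructor mesh
  field
    {len} : ℕ
    τ     : Permutation′ len
    R     : Shading len

classical : Permutation′ k → MeshPattern
classical τ = mesh τ (replicate _ ⊥)

OrderPreservingInjection : (Fin k → Fin n) → Set
OrderPreservingInjection α = α Preserves _≤ᶠ_ ⟶ _≤ᶠ_ × Injective _≡_ _≡_ α

-- The 1-based values α(0) = 0, α(1), …, α(k), α(k+1) = n + 1.
extend : (Fin k → Fin n) → Vector ℕ (suc (suc k))
extend {k} {n} α = 0 ∷ insertAt (λ i → suc (toℕ (α i))) (fromℕ k) (suc n)

-- [α(i) + 1 , α(i+1) − 1], with endpoints written as strict inequalities.
Between : (Fin k → Fin n) → Fin (suc k) → Pred (Fin n) 0ℓ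
Between α i x = extend α (inject₁ i) < suc (toℕ x) × suc (toℕ x) < extend α (fsuc i)

Region : (α β : Fin k → Fin n) → Fin (suc k) × Fin (suc k) → Pred (Fin n × Fin n) 0ℓ
Region α β (i , j) (x , y) = Between α i x × Between β j y

Image : (α β : Fin k → Fin n) → Pred (Fin k × Fin k) 0ℓ → Pred (Fin n × Fin n) 0ℓ
Image α β P (x , y) = ∃[ i ] ∃[ j ] P (i , j) × x ≡ α i × y ≡ β j

record IsOccurrence (p : MeshPattern) (π : Permutation′ n)
                    (ω : Pred (Fin n × Fin n) 0ℓ) : Set where
  open MeshPattern p
  field
    ω⊆plot : ω ⊆ Plot π
    α β    : Fin len → Fin n
    α-opi  : OrderPreservingInjection α
    β-opi  : OrderPreservingInjection β
    ω≐     : ω ≐ Image α β (Plot τ)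
    empty  : ∀ {c} → Shaded R c → Empty (Region α β c ∩ Plot π)

Avoids : MeshPattern → Pred Perm (lsuc 0ℓ)
Avoids p (n , π) = ¬ ∃ (IsOccurrence p π)

Av : Pred MeshPattern ℓ → Pred Perm (lsuc 0ℓ ⊔ ℓ)
Av S π = ∀ {p} → S p → Avoids p π

-- p₁ ∼ p₂ is  Av (｛ q ｝ ∪ ｛ p₁ ｝) ≐ Av (｛ q ｝ ∪ ｛ p₂ ｝).
coincidenceUnder : MeshPattern → Setoid 0ℓ (lsuc 0ℓ)
coincidenceUnder q = On.setoid (≐-setoid Perm (lsuc 0ℓ)) (λ p → Av (｛ q ｝ ∪ ｛ p ｝))

-- `reverse {k}` has one-line notation k (k−1) … 1.
perm21 : Permutation′ 2
perm21 = reverse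

perm321 : Permutation′ 3
perm321 = reverse

coincidence21Under321 : Setoid 0ℓ (lsuc 0ℓ)
coincidence21Under321 = On.setoid (coincidenceUnder (classical perm321)) (mesh perm21)

-- The quotient of S by its equivalence has exactly m elements.
HasExactlyClasses : Setoid a ℓ → ℕ → Set (a ⊔ ℓ)
HasExactlyClasses S m = Bijection S (setoid (Fin m))

{-# OPTIONS --safe #-}
module Submission where

-- An occurrence of (21, R) is an inversion whose shaded cells are empty. Under
-- 321 the three antidiagonal cells are always empty, which leaves 64 shadings.
-- If an inversion has a point in one of the cells 01, 10, 12, 21, then that point
-- may replace one of its two points; moving always down-left (or always
-- up-right) terminates. If the moves into some cells preserve the emptiness of R,
-- then shading these cells as well does not change the class. Together with one
-- exceptional coincidence, proved by the same descent, this reduces the 64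
-- shadings to 29, which are told apart by the six permutations 132, 213, 231,
-- 312, 2413 and 3142.

open import Defs

open import Data.Bool.Base using (Bool; if_then_else_)
import Data.Bool.Properties as Bool
open import Data.Fin.Base as Fin using (Fin; toℕ)
open import Data.Fin.Patterns
open import Data.Fin.Permutation using (Permutation′; _⟨$⟩ʳ_; permutation)
import Data.Fin.Properties as Fin
open import Data.Fin.Subset using (Subset; inside; outside; _∈_; _∪_; _─_; ⁅_⁆)
open import Data.Fin.Subset.Properties using (_∈?_; ∉⊥; anySubset?)
open import Data.List.Base using (List; []; _∷_; _++_; foldl)
open import Data.Nat.Base as ℕ using (ℕ)
open import Data.Nat.Induction using (<-wellFounded)
import Data.Nat.Properties as ℕ
open import Data.Product.Base using (∃; _×_; _,_; proj₁; proj₂)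
open import Data.Product.Properties using (≡-dec)
open import Data.Sum.Base using (_⊎_; inj₁; inj₂)
open import Data.Unit.Base using (⊤)
open import Data.Vec.Base using (Vec; []; _∷_; lookup; map; here; there)
open import Data.Vec.Properties using (lookup-map; lookup-replicate; map-cong) renaming (≡-dec to ≡-decVec)
open import Data.Vec.Relation.Unary.AllPairs using (allPairs?)
open import Data.Vec.Relation.Unary.Unique.Propositional using (Unique)
open import Data.Vec.Relation.Unary.Unique.Propositional.Properties using (lookup-injective)
open import Function.Base using (_∘_; const; id)
open import Function.Bundles using (Injection; mk⇔)
open import Function.Properties.Inverse using (↔⇒↣)
open import Induction.WellFounded using (Acc; acc)
open import Relation.Binary.Bundles using (Setoid)
open import Relation.Binary.Core using (_Preserves_⟶_)
open import Relation.Binary.Definitions using (tri<; tri≈; tri>)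
open import Relation.Binary.PropositionalEquality
open import Relation.Nullary using
  ( Dec; yes; no; does; True; toWitness; ¬_; contradiction
  ; map′; _×-dec_; _⊎-dec_; _→-dec_; ¬?; decidable-stable )
open import Relation.Nullary.Decidable using (does-⇔)
open import Relation.Unary using (_⊆_; ｛_｝)
import Relation.Unary as U

private
  variable
    n : ℕ

-- One axis of the plot, cut by two thresholds

Ordered : Fin n × Fin n → Set
Ordered (u , v) = u Fin.< v

In : Fin 3 → Fin n × Fin n → Fin n → Set
In 0F (u , v) x = x Fin.< u
In 1F (u , v) x = u Fin.< x × x Fin.< v
In 2F (u , v) x = v Fin.< x

in? : ∀ k (w : Fin n × Fin n) x → Dec (In k w x)
in? 0F (u , v) x = x Fin.<? u
in? 1F (u , v) x = u Fin.<? x ×-dec x Fin.<? v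
in? 2F (u , v) x = v Fin.<? x

data Side : Set where
  lo hi : Side

data Dir : Set where
  ↓ ↑ : Dir

flip : Side → Side
flip lo = hi
flip hi = lo

opposite : Dir → Dir
opposite ↓ = ↑
opposite ↑ = ↓

threshold : {A : Set} → Side → A × A → A
threshold lo = proj₁
threshold hi = proj₂

shift : {A : Set} → Side → A → A × A → A × A
shift lo t (u , v) = t , v
shift hi t (u , v) = u , t

-- Moving a threshold in direction d shrinks the zone `from s d` and
-- enlarges the zone `into s d`.

from into : Side → Dir → Fin 3
from lo ↓ = 0F
from lo ↑ = 1F
from hi ↓ = 1F
from hi ↑ = 2F
into lo ↓ = 1F
into lo ↑ = 0F
into hi ↓ = 2F
into hi ↑ = 1F

locate : ∀ (w : Fin n × Fin n) x → (∃ λ s → x ≡ threshold s w) ⊎ (∃ λ k → In k w x)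
locate (u , v) x with Fin.<-cmp x u | Fin.<-cmp x v
... | tri< x<u _ _ | _            = inj₂ (0F , x<u)
... | tri≈ _ x≡u _ | _            = inj₁ (lo , x≡u)
... | tri> _ _ u<x | tri< x<v _ _ = inj₂ (1F , u<x , x<v)
... | tri> _ _ u<x | tri≈ _ x≡v _ = inj₁ (hi , x≡v)
... | tri> _ _ u<x | tri> _ _ v<x = inj₂ (2F , v<x)

threshold-∉ : ∀ k s {w : Fin n × Fin n} → Ordered w → ¬ In k w (threshold s w)
threshold-∉ 0F lo u<v x<u         = Fin.<-irrefl refl x<u
threshold-∉ 0F hi u<v v<u         = Fin.<-asym u<v v<u
threshold-∉ 1F lo u<v (u<u , _)   = Fin.<-irrefl refl u<u
threshold-∉ 1F hi u<v (_ , v<v)   = Fin.<-irrefl refl v<v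
threshold-∉ 2F lo u<v v<u         = Fin.<-asym u<v v<u
threshold-∉ 2F hi u<v v<v         = Fin.<-irrefl refl v<v

shift-ordered : ∀ s d {w : Fin n × Fin n} {t} → Ordered w → In (from s d) w t → Ordered (shift s t w)
shift-ordered lo ↓ u<v t<u       = Fin.<-trans t<u u<v
shift-ordered lo ↑ u<v (_ , t<v) = t<v
shift-ordered hi ↓ u<v (u<t , _) = u<t
shift-ordered hi ↑ u<v v<t       = Fin.<-trans u<v v<t

Enlarged : Side → Dir → Fin n × Fin n → Fin 3 → Fin n → Set
Enlarged s d w k x = k ≡ into s d × (x ≡ threshold s w ⊎ In (from s d) w x)

-- The moving line sweeps over a part of the zone `from s d`. The points swept and the old threshold
-- itself are the only ones that enter a new zone, and that zone is `into s d`.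
shift-In : ∀ s d k {w : Fin n × Fin n} {t x} → Ordered w → In (from s d) w t →
           In k (shift s t w) x → In k w x ⊎ Enlarged s d w k x
shift-In lo ↓ 0F u<v t<u x<t = inj₁ (Fin.<-trans x<t t<u)
shift-In lo ↓ 1F {w} {x = x} u<v t<u (t<x , x<v) with Fin.<-cmp x (proj₁ w)
... | tri< x<u _ _ = inj₂ (refl , inj₂ x<u)
... | tri≈ _ x≡u _ = inj₂ (refl , inj₁ x≡u)
... | tri> _ _ u<x = inj₁ (u<x , x<v)
shift-In lo ↓ 2F u<v t<u v<x = inj₁ v<x
shift-In lo ↑ 0F {w} {x = x} u<v (u<t , t<v) x<t with Fin.<-cmp x (proj₁ w)
... | tri< x<u _ _ = inj₁ x<u
... | tri≈ _ x≡u _ = inj₂ (refl , inj₁ x≡u)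
... | tri> _ _ u<x = inj₂ (refl , inj₂ (u<x , Fin.<-trans x<t t<v))
shift-In lo ↑ 1F u<v (u<t , t<v) (t<x , x<v) = inj₁ (Fin.<-trans u<t t<x , x<v)
shift-In lo ↑ 2F u<v _ v<x = inj₁ v<x
shift-In hi ↓ 0F u<v _ x<u = inj₁ x<u
shift-In hi ↓ 1F u<v (u<t , t<v) (u<x , x<t) = inj₁ (u<x , Fin.<-trans x<t t<v)
shift-In hi ↓ 2F {w} {x = x} u<v (u<t , t<v) t<x with Fin.<-cmp x (proj₂ w)
... | tri< x<v _ _ = inj₂ (refl , inj₂ (Fin.<-trans u<t t<x , x<v))
... | tri≈ _ x≡v _ = inj₂ (refl , inj₁ x≡v)
... | tri> _ _ v<x = inj₁ v<x
shift-In hi ↑ 0F u<v _ x<u = inj₁ x<u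
shift-In hi ↑ 1F {w} {x = x} u<v v<t (u<x , x<t) with Fin.<-cmp x (proj₂ w)
... | tri< x<v _ _ = inj₁ (u<x , x<v)
... | tri≈ _ x≡v _ = inj₂ (refl , inj₁ x≡v)
... | tri> _ _ v<x = inj₂ (refl , inj₂ v<x)
shift-In hi ↑ 2F u<v v<t t<x = inj₁ (Fin.<-trans v<t t<x)

-- Complemented for `↑`, so that a move in either direction lowers it.
weight : Dir → Fin n → ℕ
weight     ↓ x = toℕ x
weight {n} ↑ x = n ℕ.∸ toℕ x

total : Dir → Fin n × Fin n → ℕ
total d (u , v) = weight d u ℕ.+ weight d v

∸-toℕ-< : ∀ {x y : Fin n} → x Fin.< y → n ℕ.∸ toℕ y ℕ.< n ℕ.∸ toℕ x
∸-toℕ-< {y = y} x<y = ℕ.∸-monoʳ-< x<y (ℕ.<⇒≤ (Fin.toℕ<n y))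

shift-total : ∀ s d {w : Fin n × Fin n} {t} → In (from s d) w t → total d (shift s t w) ℕ.< total d w
shift-total lo ↓ t<u                 = ℕ.+-monoˡ-< _ t<u
shift-total lo ↑ (u<t , _)           = ℕ.+-monoˡ-< _ (∸-toℕ-< u<t)
shift-total hi ↓ {w} (_ , t<v)       = ℕ.+-monoʳ-< (toℕ (proj₁ w)) t<v
shift-total hi ↑ {w} v<t             = ℕ.+-monoʳ-< (weight ↑ (proj₁ w)) (∸-toℕ-< v<t)

-- Inversions and the cells around them

Cell : Set
Cell = Fin 3 × Fin 3

Antidiagonal : Cell → Set
Antidiagonal (k , l) = toℕ k ℕ.+ toℕ l ≡ 2

-- The cell holding the points that may replace the corner s of an
-- inversion; lo is its upper left point and hi its lower right one.
box : Side → Dir → Cell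
box s d = from s d , from (flip s) d

Closed : Shading 2 → Cell → Set
Closed R c = Shaded R c ⊎ Antidiagonal c

shaded? : ∀ (R : Shading 2) c → Dec (Shaded R c)
shaded? R (k , l) = l ∈? lookup R k

closed? : ∀ R c → Dec (Closed R c)
closed? R c@(k , l) = shaded? R c ⊎-dec toℕ k ℕ.+ toℕ l ℕ.≟ 2

-- When the corner s moves to a point of box s d, a cell in column
-- `into s d` absorbs points of the cell in column `from s d`, likewise for
-- rows, and the old corner itself ends up in the cell where both lines meet.
Stable : Side → Dir → Shading 2 → Set
Stable s d R = ∀ k l → Shaded R (k , l) →
  ¬ (k ≡ into s d × l ≡ into (flip s) d) ×
  (k ≡ into s d → Closed R (from s d , l)) ×
  (l ≡ into (flip s) d → Closed R (k , from (flip s) d))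

stable? : ∀ s d R → Dec (Stable s d R)
stable? s d R = Fin.all? λ k → Fin.all? λ l → shaded? R (k , l) →-dec
  (¬? (k Fin.≟ into s d ×-dec l Fin.≟ into (flip s) d) ×-dec
  (k Fin.≟ into s d →-dec closed? R (from s d , l)) ×-dec
  (l Fin.≟ into (flip s) d →-dec closed? R (k , from (flip s) d)))

anySide? : ∀ {P : Side → Set} → (∀ s → Dec (P s)) → Dec (∃ P)
anySide? P? = map′ (λ { (inj₁ p) → lo , p ; (inj₂ p) → hi , p })
                   (λ { (lo , p) → inj₁ p ; (hi , p) → inj₂ p })
                   (P? lo ⊎-dec P? hi)

-- Moving the corners of an inversion

module _ (π : Permutation′ n) where

  private
    π⟨_⟩ : Fin n → Fin n
    π⟨ x ⟩ = π ⟨$⟩ʳ x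

  values : Fin n × Fin n → Fin n × Fin n
  values (i , j) = π⟨ j ⟩ , π⟨ i ⟩

  Inversion : Fin n × Fin n → Set
  Inversion w = Ordered w × Ordered (values w)

  InCell : Cell → Fin n × Fin n → Fin n → Set
  InCell (k , l) w x = In k w x × In l (values w) π⟨ x ⟩

  Has321 : Set
  Has321 = ∃ λ x → ∃ λ y → ∃ λ z → (x Fin.< y × y Fin.< z) × (π⟨ y ⟩ Fin.< π⟨ x ⟩ × π⟨ z ⟩ Fin.< π⟨ y ⟩)

  OccursAt : Shading 2 → Fin n × Fin n → Set
  OccursAt R w = Inversion w × (∀ c → Shaded R c → ∀ x → ¬ InCell c w x)

  Contains : Shading 2 → Set
  Contains R = ∃ (OccursAt R)

  inCell? : ∀ c w x → Dec (InCell c w x)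
  inCell? (k , l) w x = in? k w x ×-dec in? l (values w) π⟨ x ⟩

  column-avoids : ∀ k s {w x} → Inversion w → In k w x → π⟨ x ⟩ ≢ threshold s (values w)
  column-avoids k lo (i<j , _) x∈k πx≡πj with refl ← Injection.injective (↔⇒↣ π) πx≡πj = threshold-∉ k hi i<j x∈k
  column-avoids k hi (i<j , _) x∈k πx≡πi with refl ← Injection.injective (↔⇒↣ π) πx≡πi = threshold-∉ k lo i<j x∈k

  row-avoids : ∀ l s {w x} → Inversion w → In l (values w) π⟨ x ⟩ → x ≢ threshold s w
  row-avoids l lo (_ , πj<πi) πx∈l refl = threshold-∉ l hi πj<πi πx∈l
  row-avoids l hi (_ , πj<πi) πx∈l refl = threshold-∉ l lo πj<πi πx∈l

  values-shift : ∀ s w x → values (shift s x w) ≡ shift (flip s) π⟨ x ⟩ (values w)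
  values-shift lo w x = refl
  values-shift hi w x = refl

  -- A point in the cell 02, 11 or 20 comes before, between or after the two points of the inversion
  -- and completes a 321 with them.
  antidiagonal-empty : ¬ Has321 → ∀ c {w x} → Inversion w → Antidiagonal c → ¬ InCell c w x
  antidiagonal-empty no321 (0F , 2F) (i<j , πj<πi) _ (x<i , πi<πx) =
    no321 (_ , _ , _ , (x<i , i<j) , (πi<πx , πj<πi))
  antidiagonal-empty no321 (1F , 1F) _ _ ((i<x , x<j) , (πj<πx , πx<πi)) =
    no321 (_ , _ , _ , (i<x , x<j) , (πx<πi , πj<πx))
  antidiagonal-empty no321 (2F , 0F) (i<j , πj<πi) _ (j<x , πx<πj) =
    no321 (_ , _ , _ , (i<j , j<x) , (πj<πi , πx<πj))

  closed-empty : ¬ Has321 → ∀ R {w} → OccursAt R w → ∀ c → Closed R c → ∀ x → ¬ InCell c w x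
  closed-empty no321 R (_   , empty) c (inj₁ c∈R) x = empty c c∈R x
  closed-empty no321 R (inv , _)     c (inj₂ ad)  x = antidiagonal-empty no321 c inv ad

  locateCell : ∀ {w} → Inversion w → ∀ x → (∃ λ s → x ≡ threshold s w) ⊎ (∃ λ c → InCell c w x)
  locateCell {w} inv x with locate w x | locate (values w) π⟨ x ⟩
  ... | inj₁ eq      | _            = inj₁ eq
  ... | inj₂ (k , p) | inj₂ (l , q) = inj₂ ((k , l) , p , q)
  ... | inj₂ (k , p) | inj₁ (s , q) = contradiction q (column-avoids k s inv p)

  shift-inversion : ∀ s d {w x} → Inversion w → InCell (box s d) w x → Inversion (shift s x w)
  shift-inversion s d {w} {x} (i<j , πj<πi) (x∈ , πx∈) =
    shift-ordered s d i<j x∈ ,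
    subst Ordered (sym (values-shift s w x)) (shift-ordered (flip s) d πj<πi πx∈)

  -- A point in a shaded cell after the move either lay in that cell before or was passed by a
  -- moving line. If one line passed it, it came from a cell that `Stable` makes closed; if both
  -- did, it is in the cell that `Stable` forbids to be shaded.
  shift-occurs : ¬ Has321 → ∀ s d R {w x} → Stable s d R → OccursAt R w → InCell (box s d) w x → OccursAt R (shift s x w)
  shift-occurs no321 s d R {w} {x} stable occ@(inv , _) x∈@(x∈₁ , x∈₂) = shift-inversion s d inv x∈ , empty
    where
    closed : ∀ c → Closed R c → ∀ y → ¬ InCell c w y
    closed = closed-empty no321 R occ

    empty : ∀ c → Shaded R c → ∀ y → ¬ InCell c (shift s x w) y
    empty (k , l) c∈R y (y∈k , y∈l)
      with no-corner , column , row ← stable k l c∈R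
      with shift-In s d k (proj₁ inv) x∈₁ y∈k
         | shift-In (flip s) d l (proj₂ inv) x∈₂ (subst (λ v → In l v π⟨ y ⟩) (values-shift s w x) y∈l)
    ... | inj₁ p                 | inj₁ q                 = closed (k , l) (inj₁ c∈R) y (p , q)
    -- A point on an old line is a corner of the old inversion, so its other coordinate cannot lie
    -- strictly inside a zone.
    ... | inj₁ p                 | inj₂ (_ , inj₁ q)      = column-avoids k (flip s) inv p q
    ... | inj₁ p                 | inj₂ (l≡ , inj₂ q)     = closed _ (row l≡) y (p , q)
    ... | inj₂ (_ , inj₁ p)      | inj₁ q                 = row-avoids l s inv q p
    ... | inj₂ (k≡ , inj₂ p)     | inj₁ q                 = closed _ (column k≡) y (p , q)
    ... | inj₂ (k≡ , _)          | inj₂ (l≡ , _)          = no-corner (k≡ , l≡)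

  Exhausted : Dir → (Side → Set) → Fin n × Fin n → Set
  Exhausted d Active w = ∀ s → Active s → ∀ x → ¬ InCell (box s d) w x

  -- Every move lowers `total d`, which looks at positions only. Both corners move in the one
  -- direction `d`, as opposite moves could undo each other. When no move is left, the boxes of all
  -- active corners are empty at once.
  descend : ∀ d {P : Fin n × Fin n → Set} {Active : Side → Set} → (∀ s → Dec (Active s)) →
            (∀ s {w x} → Active s → P w → InCell (box s d) w x → P (shift s x w)) →
            ∃ P → ∃ λ w → P w × Exhausted d Active w
  descend d {P} {Active} active? step (w , Pw) = go w Pw (<-wellFounded (total d w))
    where
    go : ∀ w → P w → Acc ℕ._<_ (total d w) → ∃ λ w → P w × Exhausted d Active w
    go w Pw (acc smaller) with anySide? (λ s → active? s ×-dec Fin.any? (inCell? (box s d) w))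
    ... | yes (s , a , x , x∈) = go (shift s x w) (step s a Pw x∈) (smaller (shift-total s d (proj₁ x∈)))
    ... | no  ¬∃               = w , Pw , λ s a x x∈ → ¬∃ (s , a , x , x∈)

-- Shadings that force one another

Gain : Dir → Shading 2 → Cell → Set
Gain d R c = Closed R c ⊎ ∃ λ s → c ≡ box s d × Stable s d R

record Linked (d : Dir) (R S : Shading 2) : Set where
  constructor linked
  field
    grows : ∀ k l → Shaded R (k , l) → Shaded S (k , l)
    gains : ∀ k l → Shaded S (k , l) → Gain d R (k , l)

linked? : ∀ d R S → Dec (Linked d R S)
linked? d R S = map′ (λ (p , q) → linked p q) (λ (linked p q) → p , q)
  ( (Fin.all? λ k → Fin.all? λ l → shaded? R (k , l) →-dec shaded? S (k , l))
  ×-dec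
    (Fin.all? λ k → Fin.all? λ l → shaded? S (k , l) →-dec
      (closed? R (k , l) ⊎-dec anySide? λ s → ≡-dec Fin._≟_ Fin._≟_ (k , l) (box s d) ×-dec stable? s d R)))

module _ (π : Permutation′ n) where

  linked-weaken : ∀ {d R S} → Linked d R S → Contains π S → Contains π R
  linked-weaken (linked grows _) (w , inv , empty) = w , inv , λ (k , l) → empty (k , l) ∘ grows k l

  -- The descent through occurrences of `R` ends at one where the boxes of all stable corners are
  -- empty. The cells that `S` adds are such boxes or antidiagonal, so `S` occurs at the same
  -- inversion.
  linked-strengthen : ¬ Has321 π → ∀ {d R S} → Linked d R S → Contains π R → Contains π S
  linked-strengthen no321 {d} {R} {S} (linked _ gains) occR
    with w , occ@(inv , _) , exhausted ← descend π d (λ s → stable? s d R) (λ s → shift-occurs π no321 s d R) occR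
    = w , inv , empty
    where
    empty : ∀ c → Shaded S c → ∀ x → ¬ InCell π c w x
    empty (k , l) c∈S x with gains k l c∈S
    ... | inj₁ c-closed        = closed-empty π no321 R occ _ c-closed x
    ... | inj₂ (s , refl , st) = exhausted s st x

-- The entries record the cells 00, 01, 10, 12, 21, 22; the remaining three
-- are the antidiagonal ones.
core : Subset 6 → Shading 2
core (a ∷ b ∷ c ∷ d ∷ e ∷ f ∷ []) =
  (a ∷ b ∷ outside ∷ []) ∷
  (c ∷ outside ∷ d ∷ []) ∷
  (outside ∷ e ∷ f ∷ []) ∷ []

coreOf : Shading 2 → Subset 6
coreOf ((a ∷ b ∷ _ ∷ []) ∷ (c ∷ _ ∷ d ∷ []) ∷ (_ ∷ e ∷ f ∷ []) ∷ []) = a ∷ b ∷ c ∷ d ∷ e ∷ f ∷ []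

-- The gained cells are all antidiagonal, hence empty without any move. This brings the 512 shadings
-- down to 64.
core-linked : ∀ R → Linked ↓ (core (coreOf R)) R
core-linked ((a ∷ b ∷ _ ∷ []) ∷ (c ∷ _ ∷ d ∷ []) ∷ (_ ∷ e ∷ f ∷ []) ∷ []) = linked
  (λ { 0F 0F here → here
     ; 0F 1F (there here) → there here
     ; 0F 2F (there (there ()))
     ; 1F 0F here → here
     ; 1F 1F (there ())
     ; 1F 2F (there (there here)) → there (there here)
     ; 2F 0F ()
     ; 2F 1F (there here) → there here
     ; 2F 2F (there (there here)) → there (there here) })
  (λ { 0F 0F here → inj₁ (inj₁ here)
     ; 0F 1F (there here) → inj₁ (inj₁ (there here))
     ; 0F 2F _ → inj₁ (inj₂ refl)
     ; 1F 0F here → inj₁ (inj₁ here)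
     ; 1F 1F _ → inj₁ (inj₂ refl)
     ; 1F 2F (there (there here)) → inj₁ (inj₁ (there (there here)))
     ; 2F 0F _ → inj₁ (inj₂ refl)
     ; 2F 1F (there here) → inj₁ (inj₁ (there here))
     ; 2F 2F (there (there here)) → inj₁ (inj₁ (there (there here))) })

pattern □ = outside
pattern ■ = inside

-- An occurrence of either shading forces the plot to be a skew sum of two
-- increasing sequences; firstPair occurs at their first points and lastPair at
-- their last points.

firstPair lastPair : Subset 6
firstPair = ■ ∷ ■ ∷ ■ ∷ □ ∷ □ ∷ ■ ∷ []
lastPair  = ■ ∷ □ ∷ □ ∷ ■ ∷ ■ ∷ ■ ∷ []

onlyBoxes? : ∀ d R → Dec (∀ k l → Closed R (k , l) ⊎ ∃ λ s → (k , l) ≡ box s d)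
onlyBoxes? d R = Fin.all? λ k → Fin.all? λ l →
  closed? R (k , l) ⊎-dec anySide? λ s → ≡-dec Fin._≟_ Fin._≟_ (k , l) (box s d)

cornersOrBoxes? : ∀ d R → Dec (∀ k l → Shaded R (k , l) →
  ((k , l) ≡ (0F , 0F) ⊎ (k , l) ≡ (2F , 2F)) ⊎ ∃ λ s → (k , l) ≡ box s d)
cornersOrBoxes? d R = Fin.all? λ k → Fin.all? λ l → shaded? R (k , l) →-dec
  ((≡-dec Fin._≟_ Fin._≟_ (k , l) (0F , 0F) ⊎-dec ≡-dec Fin._≟_ Fin._≟_ (k , l) (2F , 2F))
  ⊎-dec anySide? λ s → ≡-dec Fin._≟_ Fin._≟_ (k , l) (box s d))

module _ (π : Permutation′ n) (no321 : ¬ Has321 π) where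

  private
    π⟨_⟩ : Fin n → Fin n
    π⟨ x ⟩ = π ⟨$⟩ʳ x

  module FirstToLast {i j : Fin n} (occ₀ : OccursAt π (core firstPair) (i , j)) where

    private
      w₀ : Fin n × Fin n
      w₀ = i , j

      inv₀ : Inversion π w₀
      inv₀ = proj₁ occ₀

      closed₀ : ∀ c → Closed (core firstPair) c → ∀ x → ¬ InCell π c w₀ x
      closed₀ = closed-empty π no321 (core firstPair) occ₀

      beyond₀ : ∀ x → ¬ InCell π (2F , 2F) w₀ x
      beyond₀ = proj₂ occ₀ (2F , 2F) (there (there here))

    -- Moves `↑` do not preserve occurrences of `core firstPair`, as the old corner would fall into
    -- the shaded cell 01 or 10. The invariant only keeps each point in its own increasing sequence,
    -- bounded by the positions and values of `w₀`.
    P : Fin n × Fin n → Set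
    P (c , d) = (i Fin.≤ c × c Fin.< j × π⟨ i ⟩ Fin.≤ π⟨ c ⟩) ×
                (j Fin.≤ d × π⟨ j ⟩ Fin.≤ π⟨ d ⟩ × π⟨ d ⟩ Fin.< π⟨ i ⟩)

    step : ∀ s {w x} → ⊤ → P w → InCell π (box s ↑) w x → P (shift s x w)
    step lo {x = x} _ ((i≤c , c<j , πi≤πc) , d-bounds) ((c<x , x<d) , πc<πx) =
      (ℕ.≤-trans i≤c (ℕ.<⇒≤ c<x) , x<j , ℕ.<⇒≤ πi<πx) , d-bounds
      where
      πi<πx : π⟨ i ⟩ Fin.< π⟨ x ⟩
      πi<πx = ℕ.≤-<-trans πi≤πc πc<πx

      -- The cell 22 of `w₀` is empty, so a point higher than `π⟨ i ⟩` cannot lie to the right of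
      -- `j`.
      x<j : x Fin.< j
      x<j with Fin.<-cmp x j
      ... | tri< x<j _ _ = x<j
      ... | tri≈ _ x≡j _ = contradiction x≡j (row-avoids π 2F hi inv₀ πi<πx)
      ... | tri> _ _ j<x = contradiction (j<x , πi<πx) (beyond₀ x)
    step hi {x = x} _ (c-bounds , (j≤d , πj≤πd , πd<πi)) (d<x , (πd<πx , πx<πc)) =
      c-bounds , (ℕ.<⇒≤ j<x , ℕ.≤-trans πj≤πd (ℕ.<⇒≤ πd<πx) , πx<πi)
      where
      j<x : j Fin.< x
      j<x = ℕ.≤-<-trans j≤d d<x

      πx<πi : π⟨ x ⟩ Fin.< π⟨ i ⟩
      πx<πi with Fin.<-cmp π⟨ x ⟩ π⟨ i ⟩
      ... | tri< πx<πi _ _ = πx<πi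
      ... | tri≈ _ eq _    = contradiction eq (column-avoids π 2F hi inv₀ j<x)
      ... | tri> _ _ πi<πx = contradiction (j<x , πi<πx) (beyond₀ x)

    occurs : ∀ {w} → P w → Exhausted π ↑ (λ _ → ⊤) w → OccursAt π (core lastPair) w
    occurs {w} ((i≤c , c<j , πi≤πc) , (j≤d , πj≤πd , πd<πi)) exhausted =
      (ℕ.<-≤-trans c<j j≤d , ℕ.<-≤-trans πd<πi πi≤πc) , empty
      where
      empty : ∀ c → Shaded (core lastPair) c → ∀ x → ¬ InCell π c w x
      empty (k , l) c∈ x x∈ with toWitness {a? = cornersOrBoxes? ↑ (core lastPair)} _ k l c∈
      ... | inj₂ (s , refl) = exhausted s _ x x∈
      ... | inj₁ (inj₂ refl) with d<x , πc<πx ← x∈ =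
        beyond₀ x (ℕ.≤-<-trans j≤d d<x , ℕ.≤-<-trans πi≤πc πc<πx)
      -- Cell 00: besides its corners, `w₀` has points only in its cells 12 and 21. Those in 12 are
      -- higher than the lower right point of `w`, those in 21 lie to the right of its upper left
      -- point.
      ... | inj₁ (inj₁ refl) with x<c , πx<πd ← x∈ with locateCell π inv₀ x
      ...   | inj₁ (lo , refl) = ℕ.<-asym πx<πd πd<πi
      ...   | inj₁ (hi , refl) = ℕ.<-asym x<c c<j
      ...   | inj₂ ((k₀ , l₀) , x∈₀) with toWitness {a? = onlyBoxes? ↑ (core firstPair)} _ k₀ l₀
      ...     | inj₁ closed      = closed₀ _ closed x x∈₀
      ...     | inj₂ (lo , refl) = ℕ.<-asym (proj₂ x∈₀) (ℕ.<-trans πx<πd πd<πi)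
      ...     | inj₂ (hi , refl) = ℕ.<-asym (proj₁ x∈₀) (ℕ.<-trans x<c c<j)

    contains : Contains π (core lastPair)
    contains with w , Pw , exhausted ← descend π ↑ (λ _ → yes _) step
                (w₀ , (ℕ.≤-refl , proj₁ inv₀ , ℕ.≤-refl) , (ℕ.≤-refl , ℕ.≤-refl , proj₂ inv₀))
      = w , occurs Pw exhausted

  -- `FirstToLast` after a half turn of the plot, which keeps 21 and 321, swaps the two corners, the
  -- two directions and the cells 00 and 22, and exchanges `firstPair` with `lastPair`.
  module LastToFirst {i j : Fin n} (occ₀ : OccursAt π (core lastPair) (i , j)) where

    private
      w₀ : Fin n × Fin n
      w₀ = i , j

      inv₀ : Inversion π w₀
      inv₀ = proj₁ occ₀

      closed₀ : ∀ c → Closed (core lastPair) c → ∀ x → ¬ InCell π c w₀ x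
      closed₀ = closed-empty π no321 (core lastPair) occ₀

      below₀ : ∀ x → ¬ InCell π (0F , 0F) w₀ x
      below₀ = proj₂ occ₀ (0F , 0F) here

    P : Fin n × Fin n → Set
    P (c , d) = (c Fin.≤ i × π⟨ j ⟩ Fin.< π⟨ c ⟩ × π⟨ c ⟩ Fin.≤ π⟨ i ⟩) ×
                (i Fin.< d × d Fin.≤ j × π⟨ d ⟩ Fin.≤ π⟨ j ⟩)

    step : ∀ s {w x} → ⊤ → P w → InCell π (box s ↓) w x → P (shift s x w)
    step lo {x = x} _ ((c≤i , πj<πc , πc≤πi) , d-bounds) (x<c , (πd<πx , πx<πc)) =
      (ℕ.<⇒≤ x<i , πj<πx , ℕ.≤-trans (ℕ.<⇒≤ πx<πc) πc≤πi) , d-bounds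
      where
      x<i : x Fin.< i
      x<i = ℕ.<-≤-trans x<c c≤i

      πj<πx : π⟨ j ⟩ Fin.< π⟨ x ⟩
      πj<πx with Fin.<-cmp π⟨ j ⟩ π⟨ x ⟩
      ... | tri< πj<πx _ _ = πj<πx
      ... | tri≈ _ eq _    = contradiction (sym eq) (column-avoids π 0F lo inv₀ x<i)
      ... | tri> _ _ πx<πj = contradiction (x<i , πx<πj) (below₀ x)
    step hi {x = x} _ (c-bounds , (i<d , d≤j , πd≤πj)) ((c<x , x<d) , πx<πd) =
      c-bounds , (i<x , ℕ.≤-trans (ℕ.<⇒≤ x<d) d≤j , ℕ.<⇒≤ πx<πj)
      where
      πx<πj : π⟨ x ⟩ Fin.< π⟨ j ⟩
      πx<πj = ℕ.<-≤-trans πx<πd πd≤πj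

      i<x : i Fin.< x
      i<x with Fin.<-cmp i x
      ... | tri< i<x _ _ = i<x
      ... | tri≈ _ i≡x _ = contradiction (sym i≡x) (row-avoids π 0F lo inv₀ πx<πj)
      ... | tri> _ _ x<i = contradiction (x<i , πx<πj) (below₀ x)

    occurs : ∀ {w} → P w → Exhausted π ↓ (λ _ → ⊤) w → OccursAt π (core firstPair) w
    occurs {w} ((c≤i , πj<πc , πc≤πi) , (i<d , d≤j , πd≤πj)) exhausted =
      (ℕ.≤-<-trans c≤i i<d , ℕ.≤-<-trans πd≤πj πj<πc) , empty
      where
      empty : ∀ c → Shaded (core firstPair) c → ∀ x → ¬ InCell π c w x
      empty (k , l) c∈ x x∈ with toWitness {a? = cornersOrBoxes? ↓ (core firstPair)} _ k l c∈
      ... | inj₂ (s , refl) = exhausted s _ x x∈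
      ... | inj₁ (inj₁ refl) with x<c , πx<πd ← x∈ =
        below₀ x (ℕ.<-≤-trans x<c c≤i , ℕ.<-≤-trans πx<πd πd≤πj)
      ... | inj₁ (inj₂ refl) with d<x , πc<πx ← x∈ with locateCell π inv₀ x
      ...   | inj₁ (lo , refl) = ℕ.<-asym d<x i<d
      ...   | inj₁ (hi , refl) = ℕ.<-asym πc<πx πj<πc
      ...   | inj₂ ((k₀ , l₀) , x∈₀) with toWitness {a? = onlyBoxes? ↓ (core lastPair)} _ k₀ l₀
      ...     | inj₁ closed      = closed₀ _ closed x x∈₀
      ...     | inj₂ (lo , refl) = ℕ.<-asym (proj₁ x∈₀) (ℕ.<-trans i<d d<x)
      ...     | inj₂ (hi , refl) = ℕ.<-asym (proj₂ x∈₀) (ℕ.<-trans πj<πc πc<πx)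

    contains : Contains π (core firstPair)
    contains with w , Pw , exhausted ← descend π ↓ (λ _ → yes _) step
                (w₀ , (ℕ.≤-refl , proj₂ inv₀ , ℕ.≤-refl) , (proj₁ inv₀ , ℕ.≤-refl , ℕ.≤-refl))
      = w , occurs Pw exhausted

-- Occurrences of patterns

StrictlyMonotone : {k : ℕ} → (Fin k → Fin n) → Set
StrictlyMonotone α = α Preserves Fin._<_ ⟶ Fin._<_

strict⇒injection : ∀ {k} {α : Fin k → Fin n} → StrictlyMonotone α → OrderPreservingInjection α
strict⇒injection {α = α} strict = monotone , injective
  where
  monotone : α Preserves Fin._≤_ ⟶ Fin._≤_
  monotone {x} {y} x≤y with x Fin.≟ y
  ... | yes refl = ℕ.≤-refl
  ... | no x≢y   = ℕ.<⇒≤ (strict (Fin.≤∧≢⇒< x≤y x≢y))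

  injective : ∀ {x y} → α x ≡ α y → x ≡ y
  injective {x} {y} eq with Fin.<-cmp x y
  ... | tri< x<y _ _ = contradiction (strict x<y) (Fin.<-irrefl eq)
  ... | tri≈ _ x≡y _ = x≡y
  ... | tri> _ _ y<x = contradiction (strict y<x) (Fin.<-irrefl (sym eq))

injection⇒strict : ∀ {k} {α : Fin k → Fin n} → OrderPreservingInjection α → StrictlyMonotone α
injection⇒strict (monotone , injective) {x} {y} x<y =
  Fin.≤∧≢⇒< (monotone (ℕ.<⇒≤ x<y)) (λ eq → Fin.<-irrefl (injective eq) x<y)

pair-strict : ∀ {x y : Fin n} → x Fin.< y → StrictlyMonotone (lookup (x ∷ y ∷ []))
pair-strict x<y {0F} {1F} _ = x<y
pair-strict x<y {1F} {1F} 1<1 = contradiction 1<1 (ℕ.<-irrefl refl)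

triple-strict : ∀ {x y z : Fin n} → x Fin.< y → y Fin.< z → StrictlyMonotone (lookup (x ∷ y ∷ z ∷ []))
triple-strict x<y y<z {0F} {1F} _ = x<y
triple-strict x<y y<z {0F} {2F} _ = Fin.<-trans x<y y<z
triple-strict x<y y<z {1F} {2F} _ = y<z
triple-strict x<y y<z {1F} {1F} p = contradiction p (ℕ.<-irrefl refl)
triple-strict x<y y<z {2F} {2F} p = contradiction p (ℕ.<-irrefl refl)
triple-strict x<y y<z {2F} {1F} p = contradiction p (ℕ.<-asym (ℕ.n<1+n 1))

module _ {k} {τ : Permutation′ k} {R : Shading k} {π : Permutation′ n} where

  embedding⇒occurrence : ∀ {α β} → StrictlyMonotone α → StrictlyMonotone β →
    (∀ i → π ⟨$⟩ʳ (α i) ≡ β (τ ⟨$⟩ʳ i)) →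
    (∀ {c} → Shaded R c → ∀ x → ¬ Region α β c (x , π ⟨$⟩ʳ x)) →
    ∃ (IsOccurrence (mesh τ R) π)
  embedding⇒occurrence {α} {β} α-strict β-strict π-α empty = Image α β (Plot τ) , record
    { ω⊆plot = λ { (i , j , refl , refl , refl) → π-α i }
    ; α-opi  = strict⇒injection α-strict
    ; β-opi  = strict⇒injection β-strict
    ; ω≐     = id , id
    ; empty  = λ { c∈R (x , _) (p , refl) → empty c∈R x p }
    }

  occurrence-plot : ∀ {ω} (o : IsOccurrence (mesh τ R) π ω) → let open IsOccurrence o in
                    ∀ i → π ⟨$⟩ʳ (α i) ≡ β (τ ⟨$⟩ʳ i)
  occurrence-plot o i = ω⊆plot (proj₂ ω≐ (i , _ , refl , refl , refl))
    where open IsOccurrence o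

-- `extend` counts from 1 and has the end values 0 and n + 1, so each outer zone acquires a bound
-- that every position satisfies.
in⇒between : ∀ k {α : Fin 2 → Fin n} {x} → In k (α 0F , α 1F) x → Between α k x
in⇒between 0F x<u         = ℕ.z<s , ℕ.s<s x<u
in⇒between 1F (u<x , x<v) = ℕ.s<s u<x , ℕ.s<s x<v
in⇒between 2F {x = x} v<x = ℕ.s<s v<x , ℕ.s<s (Fin.toℕ<n x)

between⇒in : ∀ k {α : Fin 2 → Fin n} {x} → Between α k x → In k (α 0F , α 1F) x
between⇒in 0F (_ , x<u)   = ℕ.s<s⁻¹ x<u
between⇒in 1F (u<x , x<v) = ℕ.s<s⁻¹ u<x , ℕ.s<s⁻¹ x<v
between⇒in 2F (v<x , _)   = ℕ.s<s⁻¹ v<x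

module _ {π : Permutation′ n} where

  contains⇒occurrence : ∀ {R} → Contains π R → ∃ (IsOccurrence (mesh perm21 R) π)
  contains⇒occurrence ((i , j) , (i<j , πj<πi) , empty) =
    embedding⇒occurrence (pair-strict i<j) (pair-strict πj<πi) (λ { 0F → refl ; 1F → refl })
      (λ { {k , l} c∈R x (p , q) → empty (k , l) c∈R x (between⇒in k p , between⇒in l q) })

  occurrence⇒contains : ∀ {R} → ∃ (IsOccurrence (mesh perm21 R) π) → Contains π R
  occurrence⇒contains (_ , o) =
    (α 0F , α 1F) , (injection⇒strict α-opi ℕ.z<s , subst Ordered β≡ (injection⇒strict β-opi ℕ.z<s)) ,
    λ (k , l) c∈R x (p , q) →
      empty c∈R (x , π ⟨$⟩ʳ x) ((in⇒between k p , in⇒between l (subst (λ v → In l v _) (sym β≡) q)) , refl)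
    where
    open IsOccurrence o
    -- In 21 the second position carries the lower value, so `β 0F` is the value at `α 1F`.
    β≡ : (β 0F , β 1F) ≡ values π (α 0F , α 1F)
    β≡ = sym (cong₂ _,_ (occurrence-plot o 1F) (occurrence-plot o 0F))

  has321⇒occurrence : Has321 π → ∃ (IsOccurrence (classical perm321) π)
  has321⇒occurrence (x , y , z , (x<y , y<z) , (πy<πx , πz<πy)) =
    embedding⇒occurrence (triple-strict x<y y<z) (triple-strict πz<πy πy<πx)
      (λ { 0F → refl ; 1F → refl ; 2F → refl })
      (λ { {c , _} c∈ → contradiction (subst (_ ∈_) (lookup-replicate c _) c∈) ∉⊥ })

  occurrence⇒has321 : ∃ (IsOccurrence (classical perm321) π) → Has321 π
  occurrence⇒has321 (_ , o) = α 0F , α 1F , α 2F ,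
    (injection⇒strict α-opi ℕ.z<s , injection⇒strict α-opi (ℕ.s<s ℕ.z<s)) ,
    (subst₂ Fin._<_ (sym (occurrence-plot o 1F)) (sym (occurrence-plot o 0F)) (injection⇒strict β-opi (ℕ.s<s ℕ.z<s)) ,
     subst₂ Fin._<_ (sym (occurrence-plot o 2F)) (sym (occurrence-plot o 1F)) (injection⇒strict β-opi ℕ.z<s))
    where open IsOccurrence o

-- Coincidence as mutual entailment

private
  module ≈ = Setoid coincidence21Under321
open ≈ using (_≈_)

-- A record keeps the shadings inferable from the type of a coincidence.
record _∼_ (R S : Shading 2) : Set₁ where
  constructor coincide
  field
    coincident : R ≈ S

∼-refl : ∀ {R} → R ∼ R
∼-refl {R} = coincide (≈.refl {x = R})

∼-sym : ∀ {R S} → R ∼ S → S ∼ R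
∼-sym {R} {S} (coincide p) = coincide (≈.sym {x = R} {y = S} p)

∼-trans : ∀ {R S T} → R ∼ S → S ∼ T → R ∼ T
∼-trans {R} {S} {T} (coincide p) (coincide q) = coincide (≈.trans {i = R} {j = S} {k = T} p q)

-- A permutation containing 321 lies in neither of the two classes compared, hence the restriction.
Entails : Shading 2 → Shading 2 → Set
Entails R S = ∀ {n} (π : Permutation′ n) → ¬ Has321 π → Contains π R → Contains π S

av-mono : ∀ {R S} → Entails S R →
          Av (｛ classical perm321 ｝ U.∪ ｛ mesh perm21 R ｝) ⊆ Av (｛ classical perm321 ｝ U.∪ ｛ mesh perm21 S ｝)
av-mono S⇒R {_ , π} av (inj₁ refl) = av (inj₁ refl)
av-mono S⇒R {_ , π} av (inj₂ refl) =
  av (inj₂ refl) ∘ contains⇒occurrence ∘ S⇒R π (av (inj₁ refl) ∘ has321⇒occurrence) ∘ occurrence⇒contains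

entails⇒∼ : ∀ {R S} → Entails R S → Entails S R → R ∼ S
entails⇒∼ R⇒S S⇒R = coincide (av-mono S⇒R , av-mono R⇒S)

∼⇒avoids : ∀ {n R S} → R ∼ S → (π : Permutation′ n) → ¬ Has321 π → ¬ Contains π R → ¬ Contains π S
∼⇒avoids {n} (coincide (R⊆S , _)) π no321 ¬R =
  R⊆S {n , π} (λ { (inj₁ refl) → no321 ∘ occurrence⇒has321 ; (inj₂ refl) → ¬R ∘ occurrence⇒contains }) (inj₂ refl)
  ∘ contains⇒occurrence

linked⇒∼ : ∀ {d R S} → Linked d R S → R ∼ S
linked⇒∼ link = entails⇒∼ (λ π no321 → linked-strengthen π no321 link) (λ π _ → linked-weaken π link)

firstPair∼lastPair : core firstPair ∼ core lastPair
firstPair∼lastPair = entails⇒∼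
  (λ π no321 (w , occ) → FirstToLast.contains π no321 occ)
  (λ π no321 (w , occ) → LastToFirst.contains π no321 occ)

-- Normal forms

data Adjacent (p q : Subset 6) : Set where
  gain : ∃ (λ d → Linked d (core p) (core q)) → Adjacent p q
  loss : ∃ (λ d → Linked d (core q) (core p)) → Adjacent p q
  skew : p ≡ firstPair × q ≡ lastPair → Adjacent p q

anyDir? : ∀ {P : Dir → Set} → (∀ d → Dec (P d)) → Dec (∃ P)
anyDir? P? = map′ (λ { (inj₁ p) → ↓ , p ; (inj₂ p) → ↑ , p })
                  (λ { (↓ , p) → inj₁ p ; (↑ , p) → inj₂ p })
                  (P? ↓ ⊎-dec P? ↑)

_≟ˢ_ : (p q : Subset 6) → Dec (p ≡ q)
_≟ˢ_ = ≡-decVec Bool._≟_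

adjacent? : ∀ p q → Dec (Adjacent p q)
adjacent? p q = map′
  (λ { (inj₁ x) → gain x ; (inj₂ (inj₁ x)) → loss x ; (inj₂ (inj₂ x)) → skew x })
  (λ { (gain x) → inj₁ x ; (loss x) → inj₂ (inj₁ x) ; (skew x) → inj₂ (inj₂ x) })
  (anyDir? (λ d → linked? d (core p) (core q)) ⊎-dec
   anyDir? (λ d → linked? d (core q) (core p)) ⊎-dec
   (p ≟ˢ firstPair ×-dec q ≟ˢ lastPair))

adjacent⇒∼ : ∀ {p q} → Adjacent p q → core p ∼ core q
adjacent⇒∼ (gain (d , link))    = linked⇒∼ link
adjacent⇒∼ (loss (d , link))    = ∼-sym (linked⇒∼ link)
adjacent⇒∼ (skew (refl , refl)) = firstPair∼lastPair

-- Branching on `does` lets the search run on booleans alone, without evaluating the links.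
choose : ∀ {p q} → Dec (Adjacent p q) → Subset 6
choose {p} {q} adj? = if does adj? then q else p

choose-∼ : ∀ {p q} (adj? : Dec (Adjacent p q)) → core p ∼ core (choose adj?)
choose-∼ (yes adj) = adjacent⇒∼ adj
choose-∼ (no _)    = ∼-refl

attempt : Subset 6 → (Subset 6 → Subset 6) → Subset 6
attempt p f = choose (adjacent? p (f p))

-- A candidate is accepted only if adjacent, so any list of candidates is sound. A good list matters
-- only for reaching the normal forms.
attempts-∼ : ∀ p fs → core p ∼ core (foldl attempt p fs)
attempts-∼ p []       = ∼-refl
attempts-∼ p (f ∷ fs) = ∼-trans (choose-∼ (adjacent? p (f p))) (attempts-∼ (attempt p f) fs)

-- The place of `box s d` in the encoding by `core`.
slot : Side → Dir → Subset 6
slot lo ↓ = ⁅ 1F ⁆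
slot hi ↓ = ⁅ 2F ⁆
slot lo ↑ = ⁅ 3F ⁆
slot hi ↑ = ⁅ 4F ⁆

-- The two boxes are also dropped together, since one of them, if shaded, can make moves into the
-- other unstable: {01, 10} is linked from the empty shading but not from {10}.
sweep : Dir → List (Subset 6 → Subset 6)
sweep d =
  (_∪ slot lo d) ∷ (_∪ slot hi d) ∷
  (_─ slot lo (opposite d)) ∷ (_─ slot hi (opposite d)) ∷
  (_─ (slot lo d ∪ slot hi d)) ∷ (_─ slot lo d) ∷ (_─ slot hi d) ∷ []

-- The order matters: for instance {00, 12} reaches {00} only through {00, 10, 12}.
strategy : List (Subset 6 → Subset 6)
strategy = sweep ↓ ++ sweep ↑ ++ const lastPair ∷ []

-- The results of `strategy` on the 64 shadings. Each entry is its own result, as the entries are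
-- pairwise inequivalent.
normalForms : Vec (Subset 6) 29
normalForms =
  (□ ∷ □ ∷ □ ∷ □ ∷ □ ∷ □ ∷ []) ∷
  (■ ∷ □ ∷ □ ∷ □ ∷ □ ∷ □ ∷ []) ∷
  (□ ∷ □ ∷ □ ∷ □ ∷ □ ∷ ■ ∷ []) ∷
  (■ ∷ □ ∷ □ ∷ □ ∷ □ ∷ ■ ∷ []) ∷
  (□ ∷ ■ ∷ □ ∷ ■ ∷ □ ∷ □ ∷ []) ∷
  (□ ∷ □ ∷ ■ ∷ □ ∷ ■ ∷ □ ∷ []) ∷
  (■ ∷ ■ ∷ □ ∷ ■ ∷ □ ∷ □ ∷ []) ∷
  (■ ∷ □ ∷ ■ ∷ □ ∷ ■ ∷ □ ∷ []) ∷
  (■ ∷ □ ∷ □ ∷ ■ ∷ ■ ∷ □ ∷ []) ∷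
  (■ ∷ □ ∷ □ ∷ ■ ∷ □ ∷ ■ ∷ []) ∷
  (■ ∷ □ ∷ □ ∷ □ ∷ ■ ∷ ■ ∷ []) ∷
  (□ ∷ ■ ∷ ■ ∷ ■ ∷ □ ∷ □ ∷ []) ∷
  (□ ∷ ■ ∷ ■ ∷ □ ∷ ■ ∷ □ ∷ []) ∷
  (□ ∷ ■ ∷ ■ ∷ □ ∷ □ ∷ ■ ∷ []) ∷
  (□ ∷ ■ ∷ □ ∷ ■ ∷ ■ ∷ □ ∷ []) ∷
  (□ ∷ ■ ∷ □ ∷ ■ ∷ □ ∷ ■ ∷ []) ∷
  (□ ∷ □ ∷ ■ ∷ ■ ∷ ■ ∷ □ ∷ []) ∷
  (□ ∷ □ ∷ ■ ∷ □ ∷ ■ ∷ ■ ∷ []) ∷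
  (■ ∷ ■ ∷ □ ∷ ■ ∷ ■ ∷ □ ∷ []) ∷
  (■ ∷ ■ ∷ □ ∷ ■ ∷ □ ∷ ■ ∷ []) ∷
  (■ ∷ □ ∷ ■ ∷ ■ ∷ ■ ∷ □ ∷ []) ∷
  (■ ∷ □ ∷ ■ ∷ □ ∷ ■ ∷ ■ ∷ []) ∷
  (■ ∷ □ ∷ □ ∷ ■ ∷ ■ ∷ ■ ∷ []) ∷
  (□ ∷ ■ ∷ ■ ∷ ■ ∷ ■ ∷ □ ∷ []) ∷
  (□ ∷ ■ ∷ ■ ∷ ■ ∷ □ ∷ ■ ∷ []) ∷
  (□ ∷ ■ ∷ ■ ∷ □ ∷ ■ ∷ ■ ∷ []) ∷
  (■ ∷ ■ ∷ ■ ∷ ■ ∷ ■ ∷ □ ∷ []) ∷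
  (□ ∷ ■ ∷ ■ ∷ ■ ∷ ■ ∷ ■ ∷ []) ∷
  (■ ∷ ■ ∷ ■ ∷ ■ ∷ ■ ∷ ■ ∷ []) ∷
  []

allSubset? : ∀ {m} {P : Subset m → Set} → (∀ p → Dec (P p)) → Dec (∀ p → P p)
allSubset? P? = map′
  (λ ¬∃ p → decidable-stable (P? p) λ ¬Pp → ¬∃ (p , ¬Pp))
  (λ ∀P (p , ¬Pp) → ¬Pp (∀P p))
  (¬? (anySubset? λ p → ¬? (P? p)))

Tabulated : Subset 6 → Set
Tabulated p = ∃ λ i → p ≡ lookup normalForms i

tabulated? : ∀ p → Dec (Tabulated p)
tabulated? p = Fin.any? λ i → p ≟ˢ lookup normalForms i

representative : Fin 29 → Shading 2
representative = core ∘ lookup normalForms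

represented : ∀ fs → (∀ p → Tabulated (foldl attempt p fs)) → ∀ p → ∃ λ i → core p ∼ representative i
represented fs tabulated p =
  proj₁ (tabulated p) , subst (λ q → core p ∼ core q) (proj₂ (tabulated p)) (attempts-∼ p fs)

-- Unfolded at a variable shading, this would evaluate the whole search.
abstract
  core-represented : ∀ p → ∃ λ i → core p ∼ representative i
  core-represented =
    represented strategy (toWitness {a? = allSubset? λ p → tabulated? (foldl attempt p strategy)} _)

classify : ∀ R → ∃ λ i → R ∼ representative i
classify R = proj₁ core∼ , ∼-trans (∼-sym (linked⇒∼ (core-linked R))) (proj₂ core∼)
  where
  core∼ : ∃ λ i → core (coreOf R) ∼ representative i
  core∼ = core-represented (coreOf R)

-- Separating the classes

module _ (π : Permutation′ n) where

  occursAt? : ∀ R w → Dec (OccursAt π R w)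
  occursAt? R w@(i , j) = (i Fin.<? j ×-dec (π ⟨$⟩ʳ j) Fin.<? (π ⟨$⟩ʳ i)) ×-dec
    map′ (λ f (k , l) → f k l) (λ f k l → f (k , l))
      (Fin.all? λ k → Fin.all? λ l → shaded? R (k , l) →-dec Fin.all? λ x → ¬? (inCell? π (k , l) w x))

  contains? : ∀ R → Dec (Contains π R)
  contains? R = map′ (λ (i , j , occ) → (i , j) , occ) (λ ((i , j) , occ) → i , j , occ)
    (Fin.any? λ i → Fin.any? λ j → occursAt? R (i , j))

  has321? : Dec (Has321 π)
  has321? = Fin.any? λ x → Fin.any? λ y → Fin.any? λ z →
    (x Fin.<? y ×-dec y Fin.<? z) ×-dec
    ((π ⟨$⟩ʳ y) Fin.<? (π ⟨$⟩ʳ x) ×-dec (π ⟨$⟩ʳ z) Fin.<? (π ⟨$⟩ʳ y))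

Avoider : Set
Avoider = ∃ λ n → ∃ λ (π : Permutation′ n) → ¬ Has321 π

inverse? : (f g : Vec (Fin n) n) → Dec (∀ i → lookup f (lookup g i) ≡ i)
inverse? f g = Fin.all? λ i → lookup f (lookup g i) Fin.≟ i

oneLine : (f f⁻¹ : Vec (Fin n) n) → True (inverse? f f⁻¹) → True (inverse? f⁻¹ f) → Permutation′ n
oneLine f f⁻¹ l r = permutation (lookup f) (lookup f⁻¹) (toWitness l) (toWitness r)

avoider : (f f⁻¹ : Vec (Fin n) n) {l : True (inverse? f f⁻¹)} {r : True (inverse? f⁻¹ f)} →
          {True (¬? (has321? (oneLine f f⁻¹ l r)))} → Avoider
avoider f f⁻¹ {l} {r} {no321} = _ , oneLine f f⁻¹ l r , toWitness no321

-- Each is given with its inverse. Listing the cells occupied around every inversion shows what is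
-- detected: 132 is avoided iff 00 is shaded, 213 iff 22 is, 231 iff 01 and 12 are, 312 iff 10 and
-- 21 are; 2413 iff each of {12, 22}, {01, 21}, {00, 10} has a shaded cell, and 3142 iff each of
-- {21, 22}, {10, 12}, {00, 01} has.
avoiders : Vec Avoider 6
avoiders =
  avoider (0F ∷ 2F ∷ 1F ∷ []) (0F ∷ 2F ∷ 1F ∷ []) ∷
  avoider (1F ∷ 0F ∷ 2F ∷ []) (1F ∷ 0F ∷ 2F ∷ []) ∷
  avoider (1F ∷ 2F ∷ 0F ∷ []) (2F ∷ 0F ∷ 1F ∷ []) ∷
  avoider (2F ∷ 0F ∷ 1F ∷ []) (1F ∷ 2F ∷ 0F ∷ []) ∷
  avoider (1F ∷ 3F ∷ 0F ∷ 2F ∷ []) (2F ∷ 0F ∷ 3F ∷ 1F ∷ []) ∷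
  avoider (2F ∷ 0F ∷ 3F ∷ 1F ∷ []) (1F ∷ 3F ∷ 0F ∷ 2F ∷ []) ∷ []

fingerprint : Shading 2 → Vec Bool 6
fingerprint R = map (λ (_ , π , _) → does (contains? π R)) avoiders

fingerprint-cong : ∀ {R S} → R ∼ S → fingerprint R ≡ fingerprint S
fingerprint-cong {R} {S} R∼S = map-cong
  (λ (_ , π , no321) → does-⇔
    (mk⇔ (transfer {R} {S} R∼S π no321) (transfer {S} {R} (∼-sym R∼S) π no321))
    (contains? π R) (contains? π S))
  avoiders
  where
  transfer : ∀ {R S} → R ∼ S → Entails R S
  -- Coincidence speaks of avoidance only; containment is recovered because it is decidable.
  transfer {S = S} R∼S π no321 c = decidable-stable (contains? π S) (λ ¬S → ∼⇒avoids (∼-sym R∼S) π no321 ¬S c)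

fingerprints : Vec (Vec Bool 6) 29
fingerprints = map (fingerprint ∘ core) normalForms

fingerprints-unique : Unique fingerprints
fingerprints-unique = toWitness {a? = allPairs? (λ p q → ¬? (p ≟ˢ q)) fingerprints} _

representative-injective : ∀ k l → representative k ∼ representative l → k ≡ l
representative-injective k l k∼l = lookup-injective fingerprints-unique k l
  (trans (lookup-map k (fingerprint ∘ core) normalForms)
  (trans (fingerprint-cong k∼l)
         (sym (lookup-map l (fingerprint ∘ core) normalForms))))

-- Completeness of the representatives defines the map to indices; their irredundance makes it
-- respect the equivalence and send `r k` to `k`.
exactlyClasses : ∀ {a ℓ m} (S : Setoid a ℓ) → let module S = Setoid S in (r : Fin m → S.Carrier) →
                 (∀ x → ∃ λ k → x S.≈ r k) → (∀ k l → r k S.≈ r l → k ≡ l) → HasExactlyClasses S m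
exactlyClasses S r complete irredundant = record
  { to        = index
  ; cong      = index-cong
  ; bijective = (λ {x} {y} eq → S.trans (x≈ x) (S.sym (subst (λ k → y S.≈ r k) (sym eq) (x≈ y)))) ,
                λ k → r k , λ {z} z≈rk → irredundant _ _ (S.trans (S.sym (x≈ z)) z≈rk)
  }
  where
  module S = Setoid S

  index : S.Carrier → Fin _
  index x = proj₁ (complete x)

  x≈ : ∀ x → x S.≈ r (index x)
  x≈ x = proj₂ (complete x)

  index-cong : ∀ {x y} → x S.≈ y → index x ≡ index y
  index-cong {x} {y} x≈y = irredundant _ _ (S.trans (S.sym (x≈ x)) (S.trans x≈y (x≈ y)))

mainTheorem4 : HasExactlyClasses coincidence21Under321 29
mainTheorem4 = exactlyClasses coincidence21Under321 representative
  (λ R → proj₁ (classify R) , _∼_.coincident (proj₂ (classify R)))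
  (λ k l k≈l → representative-injective k l (coincide {R = representative k} {S = representative l} k≈l))
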